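{- For every natural number $n$, $\omega\to(\widetilde{\mathcal{ED}}_\omega^+)^2_n$; in particular $\omega\to(\mathcal{PC}^+)^2_n$.
   Context: Fix a family $\{A_s\subseteq\omega: s\in\omega^{<\omega}\}$ such that $A_\emptyset=\omega$, every $A_s$ is infinite, $\{A_{s^\frown n}:n\in\omega\}$ is a partition of $A_s$, and for distinct $n,m\in\omega$ there exist $s\neq t$ in $\omega^{<\omega}$ with $n\in A_s$, $m\in A_t$. Let $\mathcal{B}=\{A\subseteq\omega: \exists s\in\omega^{<\omega}\,(A\subseteq A_s\wedge\forall n\in\omega\ |A\cap A_{s^\frown n}|=1)\}$ and $\mathcal{A}_m=\{A_s: |s|=m+1\}$. $\widetilde{\mathcal{ED}}_m$ is the ideal on $\omega$ generated by $\mathcal{A}_m\cup\mathcal{B}$ (and finite sets), and $\widetilde{\mathcal{ED}}_\omega=\bigcap_{m\in\omega}\widetilde{\mathcal{ED}}_m$. For $A\subseteq\omega$ let $T_A=\{s: A\cap A_s\neq\emptyset\}$; a tree $T\subseteq\omega^{<\omega}$ is small-branching if each $s\in T$ has at most $|s|+1$ immediate successors in $T$. $\mathcal{PC}$ is the ideal generated by $\mathcal{B}\cup\{A\subseteq\omega: T_A\text{ is small-branching}\}$ (and finite sets). For an ideal $\mathcal{I}$, $\mathcal{I}^+$ is the family of sets not in $\mathcal{I}$, and $\omega\to(\mathcal{I}^+)^2_n$ means: for every $c:[\omega]^2\to n$ there is $A\in\mathcal{I}^+$ with $|c[[A]^2]|=1$. -}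

module Defs where

open import Level using (Level; 0ℓ) renaming (suc to lsuc)
open import Data.Nat using (ℕ; suc; _≤_; _<_)
open import Data.Fin using (Fin)
open import Data.List using (List; []; _∷_; _++_; [_]; length)
open import Data.List.Relation.Unary.All using (All)
open import Data.List.Relation.Unary.Any using (Any)
open import Data.List.Membership.Propositional using (_∈_)
open import Data.Product using (Σ; ∃; ∃-syntax; _×_; _,_)
open import Data.Sum using (_⊎_)
open import Relation.Nullary using (¬_)
open import Relation.Binary.PropositionalEquality using (_≡_)

Subset : Set₁
Subset = ℕ → Set

_⊆_ : Subset → Subset → Set
X ⊆ Y = ∀ k → X k → Y k

Seq : Set
Seq = List ℕ

_⌢_ : Seq → ℕ → Seq
s ⌢ n = s ++ [ n ]

Infinite : Subset → Set
Infinite X = ∀ m → ∃[ k ] (m ≤ k × X k)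

record IsTreeFamily (A : Seq → Subset) : Set where
  field
    root     : ∀ k → A [] k
    infinite : ∀ s → Infinite (A s)
    covers   : ∀ s k → A s k → ∃[ n ] A (s ⌢ n) k
    sub      : ∀ s n k → A (s ⌢ n) k → A s k
    disjoint : ∀ s n m k → A (s ⌢ n) k → A (s ⌢ m) k → n ≡ m
    separate : ∀ n m → ¬ n ≡ m →
               ∃[ s ] ∃[ t ] (¬ s ≡ t × A s n × A t m)

ExactlyOne : Subset → Subset → Set
ExactlyOne X Y = ∃[ k ] (X k × Y k × (∀ k' → X k' → Y k' → k' ≡ k))

𝓑 : (Seq → Subset) → Subset → Set
𝓑 A X = ∃[ s ] (X ⊆ A s × (∀ n → ExactlyOne X (A (s ⌢ n))))

𝓐 : (Seq → Subset) → ℕ → Subset → Set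
𝓐 A m X = ∃[ s ] (length s ≡ suc m × X ⊆ A s × A s ⊆ X)

Generated : (Subset → Set) → Subset → Set₁
Generated 𝓖 X =
  Σ (List Subset) λ gs → All 𝓖 gs ×
    ∃[ N ] (∀ x → X x → x < N ⊎ Any (λ g → g x) gs)

ED̃ : (Seq → Subset) → ℕ → Subset → Set₁
ED̃ A m = Generated (λ G → 𝓐 A m G ⊎ 𝓑 A G)

ED̃ω : (Seq → Subset) → Subset → Set₁
ED̃ω A X = ∀ m → ED̃ A m X

T[_] : (Seq → Subset) → Subset → Seq → Set
T[ A ] X s = ∃[ k ] (X k × A s k)

SmallBranching : (Seq → Set) → Set
SmallBranching T =
  ∀ s → T s → Σ (List ℕ) λ L → length L ≤ suc (length s) ×
    (∀ n → T (s ⌢ n) → n ∈ L)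

PC : (Seq → Subset) → Subset → Set₁
PC A = Generated (λ G → 𝓑 A G ⊎ SmallBranching (T[ A ] G))

-- c : [ω]² → n, given on pairs x < y.
Homogeneous : ∀ {n} → (ℕ → ℕ → Fin n) → Subset → Set
Homogeneous {n} c X =
  ∃[ i ] (∀ x y → x < y → X x → X y → c x y ≡ i)

Arrow : (Subset → Set₁) → ℕ → Set₁
Arrow 𝓘 n = (c : ℕ → ℕ → Fin n) →
  Σ Subset λ X → ¬ 𝓘 X × Homogeneous c X

{-# OPTIONS --safe #-}
-- If for infinitely many k the sets A (s ⌢ k) contain more and more points of X,
-- then X is positive for ED̃ A (length s) and for PC A: each generator meets almost
-- every A (s ⌢ k) in at most one point.  To find such a homogeneous X, start with a
-- set that branches infinitely at n levels.  On such a set Y at a node s some colour e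
-- is generic: finitely many points, chosen from a suitable large subset, are joined
-- by e to all points of a smaller large subset.  Either arbitrarily large e-cliques
-- keep occurring below infinitely many children of s, and their union is X; or some
-- large subset of Y below a child of s has bounded e-cliques.  There e is never
-- generic again, so the second case happens at most n times.
module Submission where

open import Defs
open import Level using (0ℓ; Lift; lift; lower) renaming (suc to lsuc)
open import Axiom.ExcludedMiddle using (ExcludedMiddle)
open import Data.Empty using (⊥-elim)
open import Data.Fin as Fin using (Fin; zero; suc; punchIn; punchOut)
open import Data.Fin.Properties as Fin using (punchIn-punchOut; pigeonhole)
open import Data.List using ([]; _∷_; _++_; length; lookup)
open import Data.List.Membership.Propositional.Properties using (∈-lookup)
open import Data.List.Properties using (++-assoc; ++-identityʳ; length-++)
open import Data.List.Relation.Unary.All as All using ()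
open import Data.List.Relation.Unary.Any as Any using ()
open import Data.List.Relation.Unary.Any.Properties using (lookup-index)
open import Data.Nat using (ℕ; zero; suc; _⊔_; _≤_; _<_; z≤n; s≤s)
open import Data.Nat.Properties
open import Data.Product using (Σ; ∃-syntax; _×_; _,_; proj₁; proj₂)
open import Data.Sum using (_⊎_; inj₁; inj₂; [_,_]′; fromInj₂)
open import Data.Unit using (⊤; tt)
open import Function using (_∘_; id)
open import Relation.Binary.Definitions using (tri<; tri≈; tri>)
open import Relation.Binary.PropositionalEquality
  using (_≡_; refl; sym; trans; cong; subst)
open import Relation.Nullary using (¬_; Dec; yes; no; contradiction)
open import Relation.Nullary.Decidable using (map′; decidable-stable)

-- Finite bounds and classical principles.

upper-bound : ∀ {n} (f : Fin n → ℕ) → ∃[ b ] (∀ i → f i ≤ b)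
upper-bound {zero}  f = 0 , λ ()
upper-bound {suc n} f with upper-bound (f ∘ suc)
... | b , f≤b = f zero ⊔ b , λ where
  zero    → m≤m⊔n (f zero) b
  (suc i) → ≤-trans (f≤b i) (m≤n⊔m (f zero) b)

module Classical (em : ExcludedMiddle (lsuc 0ℓ)) where

  dec : (P : Set) → Dec P
  dec P = map′ lower lift (em {Lift (lsuc 0ℓ) P})

  dne : {P : Set} → ¬ ¬ P → P
  dne {P} = decidable-stable (dec P)

  ¬∀⟶∃¬ : {I : Set} {P : I → Set} → ¬ (∀ i → P i) → ∃[ i ] ¬ P i
  ¬∀⟶∃¬ ¬all = dne λ none → ¬all λ i → dne λ ¬Pi → none (i , ¬Pi)

  infinite-pigeonhole : ∀ {n} (P : Fin n → Subset) →
    Infinite (λ k → ∃[ e ] P e k) → ∃[ e ] Infinite (P e)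
  infinite-pigeonhole P inf = dne λ none →
    let bounded e = ¬∀⟶∃¬ (λ Pe → none (e , Pe))
        b , ≤b    = upper-bound (proj₁ ∘ bounded)
        k , b≤k , e , Pek = inf b
    in proj₂ (bounded e) (k , ≤-trans (≤b e) b≤k , Pek)

module TreeFamily (em : ExcludedMiddle (lsuc 0ℓ))
                  (A : Seq → Subset) (tree : IsTreeFamily A) where
  open Classical em
  open IsTreeFamily tree

  -- Comparability of nodes whose sets meet.

  A-prefix : ∀ s u → A (s ++ u) ⊆ A s
  A-prefix s []      x p = subst (λ t → A t x) (++-identityʳ s) p
  A-prefix s (k ∷ u) x p =
    sub s k x (A-prefix (s ⌢ k) u x
      (subst (λ t → A t x) (sym (++-assoc s (k ∷ []) u)) p))

  A-child : ∀ s k u → A (s ++ k ∷ u) ⊆ A (s ⌢ k)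
  A-child s k u x p =
    A-prefix (s ⌢ k) u x (subst (λ t → A t x) (sym (++-assoc s (k ∷ []) u)) p)

  data Comparable (s t : Seq) : Set where
    equal : s ≡ t → Comparable s t
    below : ∀ k u → t ≡ s ++ k ∷ u → Comparable s t
    above : ∀ k u → s ≡ t ++ k ∷ u → Comparable s t

  -- Disjointness of siblings forces the first entries to agree; `p` collects the entries already
  -- matched.
  comparable-after : ∀ p s t x → A (p ++ s) x → A (p ++ t) x → Comparable s t
  comparable-after p []      []      x _ _ = equal refl
  comparable-after p []      (k ∷ t) x _ _ = below k t refl
  comparable-after p (k ∷ s) []      x _ _ = above k s refl
  comparable-after p (k ∷ s) (l ∷ t) x q r
    with refl ← disjoint p k l x (A-child p k s x q) (A-child p l t x r)
    with comparable-after (p ⌢ k) s t x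
           (subst (λ v → A v x) (sym (++-assoc p (k ∷ []) s)) q)
           (subst (λ v → A v x) (sym (++-assoc p (k ∷ []) t)) r)
  ... | equal refl     = equal refl
  ... | below j u refl = below j u refl
  ... | above j u refl = above j u refl

  comparable : ∀ s t x → A s x → A t x → Comparable s t
  comparable = comparable-after []

  -- Thinness of the generators at a node.

  Thin : Seq → Subset → Set
  Thin s G = ∃[ K ] (∀ k → K ≤ k → ∀ x y →
    G x → A (s ⌢ k) x → G y → A (s ⌢ k) y → x ≡ y)

  thin-if-outside : ∀ s G → (∀ x → G x → ¬ A s x) → Thin s G
  thin-if-outside s G out =
    0 , λ k _ x y Gx Ax _ _ → ⊥-elim (out x Gx (sub s k x Ax))

  thin-if-in-child : ∀ s k G → G ⊆ A (s ⌢ k) → Thin s G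
  thin-if-in-child s k G G⊆ = suc k , λ l k<l x y Gx Ax _ _ →
    contradiction (disjoint s k l x (G⊆ x Gx) Ax) (<⇒≢ k<l)

  thin-by-cases : ∀ s t G → G ⊆ A t → (Comparable s t → Thin s G) → Thin s G
  thin-by-cases s t G G⊆ f with dec (∃[ x ] (G x × A s x))
  ... | yes (x , Gx , Ax) = f (comparable s t x Ax (G⊆ x Gx))
  ... | no  none          = thin-if-outside s G λ x Gx Ax → none (x , Gx , Ax)

  -- The node of `G` is one level longer than `s`, so `G` lies inside one child of `s` or misses
  -- `A s`.
  thin-𝓐 : ∀ s G → 𝓐 A (length s) G → Thin s G
  thin-𝓐 s G (t , |t| , G⊆ , _) = thin-by-cases s t G G⊆ λ where
    (equal refl)     → contradiction |t| (<⇒≢ (n<1+n _))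
    (below k u refl) → thin-if-in-child s k G λ x Gx → A-child s k u x (G⊆ x Gx)
    (above k u refl) → contradiction
      (subst (_≤ length (t ++ k ∷ u)) |t|
        (subst (length t ≤_) (sym (length-++ t)) (m≤m+n (length t) _)))
      (<⇒≱ (n<1+n _))

  -- A selector for a node below `s` stays in one child of `s`; for a node above `s`, all of `A s`
  -- lies in one of that node's children and contains at most one point of `G`.
  thin-𝓑 : ∀ s G → 𝓑 A G → Thin s G
  thin-𝓑 s G (t , G⊆ , one) = thin-by-cases s t G G⊆ λ where
      (equal refl)     → 0 , λ k _ x y Gx Ax Gy Ay → unique k Gx Ax Gy Ay
      (below k u refl) → thin-if-in-child s k G λ x Gx → A-child s k u x (G⊆ x Gx)
      (above k u refl) → 0 , λ l _ x y Gx Ax Gy Ay →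
        unique k Gx (A-child t k u x (sub s l x Ax)) Gy (A-child t k u y (sub s l y Ay))
    where
    unique : ∀ k {x y} → G x → A (t ⌢ k) x → G y → A (t ⌢ k) y → x ≡ y
    unique k Gx Ax Gy Ay =
      let _ , _ , _ , only = one k in trans (only _ Gx Ax) (sym (only _ Gy Ay))

  thin-small-branching : ∀ s G → SmallBranching (T[ A ] G) → Thin s G
  thin-small-branching s G small with dec (T[ A ] G s)
  ... | no  none = thin-if-outside s G λ x Gx Ax → none (x , Gx , Ax)
  ... | yes Ts   =
    let L , _ , children∈L = small s Ts
        b , L≤b            = upper-bound (lookup L)
    in suc b , λ k b<k x y Gx Ax _ _ →
         let k∈L = children∈L k (x , Gx , Ax)
         in contradiction
              (subst (_≤ b) (sym (lookup-index k∈L)) (L≤b (Any.index k∈L)))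
              (<⇒≱ b<k)

  -- Tall sets are positive.

  Tall : Seq → Subset → Set
  Tall s X = ∀ N → ∃[ k ] (N ≤ k × Σ (Fin N → ℕ) λ F →
    (∀ i → X (F i) × A (s ⌢ k) (F i) × N ≤ F i) ×
    (∀ {i j} → i Fin.< j → F i < F j))

  -- Take `N` above the number of generators, every thinness threshold and the finite exceptional
  -- set. Two of the `N` points then share a generator and a child, against thinness.
  tall-positive : ∀ s (𝓖 : Subset → Set) → (∀ G → 𝓖 G → Thin s G) →
    ∀ X → Tall s X → ¬ Generated 𝓖 X
  tall-positive s 𝓖 thin X tall (gs , 𝓖gs , B , cover) =
    let thin-at a   = thin _ (All.lookup 𝓖gs (∈-lookup {xs = gs} a))
        K , ≤K      = upper-bound (proj₁ ∘ thin-at)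
        k , N≤k , F , F∈ , F< = tall (suc (length gs) ⊔ (K ⊔ B))
        K⊔B≤N       = m≤n⊔m (suc (length gs)) (K ⊔ B)
        B≤F i       = ≤-trans (m⊔n≤o⇒n≤o K B K⊔B≤N) (proj₂ (proj₂ (F∈ i)))
        covered i   = fromInj₂ (λ F<B → contradiction F<B (≤⇒≯ (B≤F i)))
                               (cover (F i) (proj₁ (F∈ i)))
        i , j , i<j , same =
          pigeonhole (m≤m⊔n (suc (length gs)) (K ⊔ B)) (Any.index ∘ covered)
        a           = Any.index (covered j)
        Fi∈         = subst (λ a → lookup gs a (F i)) same (lookup-index (covered i))
        Fj∈         = lookup-index (covered j)
    in contradiction
         (proj₂ (thin-at a) k
           (≤-trans (≤K a) (≤-trans (m⊔n≤o⇒m≤o K B K⊔B≤N) N≤k))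
           (F i) (F j) Fi∈ (proj₁ (proj₂ (F∈ i))) Fj∈ (proj₁ (proj₂ (F∈ j))))
         (<⇒≢ (F< i<j))

  -- Positivity for iterated Fubini powers of the ideal of finite sets.

  Large : ℕ → Subset → Seq → Set
  Large zero    Y s = Infinite (λ y → Y y × A s y)
  Large (suc d) Y s = Infinite (λ k → Large d Y (s ⌢ k))

  large-everything : ∀ d s → Large d (λ _ → ⊤) s
  large-everything zero    s m = let k , m≤k , Ak = infinite s m in k , m≤k , tt , Ak
  large-everything (suc d) s m = m , ≤-refl , large-everything d (s ⌢ m)

  large-mono : ∀ d {Y Z} s → Y ⊆ Z → Large d Y s → Large d Z s
  large-mono zero    s Y⊆Z L m =
    let y , m≤y , Yy , Ay = L m in y , m≤y , Y⊆Z y Yy , Ay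
  large-mono (suc d) s Y⊆Z L m =
    let k , m≤k , L′ = L m in k , m≤k , large-mono d (s ⌢ k) Y⊆Z L′

  large-inhabited : ∀ d {Y} s → Large d Y s → ∃[ y ] (Y y × A s y)
  large-inhabited zero    s L = let y , _ , p = L 0 in y , p
  large-inhabited (suc d) s L =
    let k , _ , L′   = L 0
        y , Yy , Aky = large-inhabited d (s ⌢ k) L′
    in y , Yy , sub s k y Aky

  -- The pigeonhole is applied at every level: to points at the leaves, to the colours found in the
  -- children above. Requiring `x < y` costs finitely many points per leaf.
  large-partition : ∀ {n} (f : ℕ → Fin n) x d {Y} s → Large d Y s →
    ∃[ e ] Large d (λ y → Y y × x < y × f y ≡ e) s
  large-partition f x zero    {Y} s L =
    infinite-pigeonhole (λ e y → (Y y × x < y × f y ≡ e) × A s y) λ m →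
      let y , le , Yy , Ay = L (m ⊔ suc x)
      in y , m⊔n≤o⇒m≤o m (suc x) le , f y ,
         (Yy , m⊔n≤o⇒n≤o m (suc x) le , refl) , Ay
  large-partition f x (suc d) {Y} s L =
    infinite-pigeonhole (λ e k → Large d (λ y → Y y × x < y × f y ≡ e) (s ⌢ k)) λ m →
      let k , m≤k , L′ = L m
      in k , m≤k , large-partition f x d (s ⌢ k) L′

  -- Generic colours.

  module Colouring {n} (c : ℕ → ℕ → Fin n) where

    -- This is the end-homogeneity of Ramsey's theorem, with large sets for infinite ones: a point
    -- `x` of any `Z i` has the same colour towards every `Z j` with `x < j`.
    record Generic (d : ℕ) (Y : Subset) (s : Seq) : Set₁ where
      field
        colour     : Fin n
        Z          : ℕ → Subset
        Z-large    : ∀ j → Large d (Z j) s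
        Z⊆Y        : ∀ j → Z j ⊆ Y
        Z-antitone : ∀ {i j} → i ≤ j → Z j ⊆ Z i
        Z-≥        : ∀ {j y} → Z j y → j ≤ y
        joined     : ∀ {i j x y} → x < j → Z i x → Z j y → c x y ≡ colour

    module _ {d Y s} (Y-large : Large d Y s) where

      -- All points of W (suc x) are joined to x by the colour limit x.
      refined : ℕ → ∃[ W ] Large d W s
      refined zero    = Y , Y-large
      refined (suc x) =
        let W , W-large = refined x
        in _ , proj₂ (large-partition (c x) x d s W-large)

      W : ℕ → Subset
      W = proj₁ ∘ refined

      limit : ℕ → Fin n
      limit x = proj₁ (large-partition (c x) x d s (proj₂ (refined x)))

      W-antitone : ∀ {i j} → i ≤ j → W j ⊆ W i
      W-antitone {i} {j} i≤j y Wy with m≤n⇒m<n∨m≡n i≤j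
      ... | inj₂ refl = Wy
      W-antitone {i} {suc j} _ y Wy | inj₁ (s≤s i≤j) = W-antitone i≤j y (proj₁ Wy)

      W-≥ : ∀ j {y} → W j y → j ≤ y
      W-≥ zero    _  = z≤n
      W-≥ (suc j) Wy = proj₁ (proj₂ Wy)

      generic : Generic d Y s
      generic =
        -- Each `W m` has a large part with constant `limit`; one constant `e` occurs for infinitely
        -- many `m`, which suffices because `W` decreases.
        let e , often = infinite-pigeonhole
              (λ e j → Large d (λ y → W j y × j ≤ y × limit y ≡ e) s)
              (λ m → m , ≤-refl , restrict m)
        in record
          { colour     = e
          ; Z          = λ j y → W j y × limit y ≡ e
          ; Z-large    = λ j → let j′ , j≤j′ , L = often j in
              large-mono d s (λ y (Wy , _ , l) → W-antitone j≤j′ y Wy , l) L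
          ; Z⊆Y        = λ j y (Wy , _) → W-antitone {0} {j} z≤n y Wy
          ; Z-antitone = λ i≤j y (Wy , l) → W-antitone i≤j y Wy , l
          ; Z-≥        = λ {j} (Wy , _) → W-≥ j Wy
          ; joined     = λ {i} {j} {x} {y} x<j (_ , l) (Wy , _) →
              -- `x < j` puts `y` into `W (suc x)`, so `c x y` is `limit x`.
              trans (proj₂ (proj₂ (W-antitone x<j y Wy))) l
          }
        where
        restrict : ∀ m → ∃[ e ] Large d (λ y → W m y × m ≤ y × limit y ≡ e) s
        restrict m =
          let e , L = large-partition limit m d s (proj₂ (refined m))
          in e , large-mono d s (λ y (Wy , m<y , l) → Wy , <⇒≤ m<y , l) L

    -- Cliques in a generic colour.

    Clique : Fin n → ℕ → Subset → Set
    Clique e N P = Σ (Fin N → ℕ) λ F → (∀ i → P (F i)) ×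
      (∀ {i j} → i Fin.< j → F i < F j × c (F i) (F j) ≡ e)

    clique-mono : ∀ {e N} P Q → P ⊆ Q → Clique e N P → Clique e N Q
    clique-mono P Q P⊆Q (F , FP , F<) = F , (λ i → P⊆Q (F i) (FP i)) , F<

    Bounded : Subset → Seq → Fin n → Set
    Bounded Y s e = ∃[ N ] ¬ Clique e N (λ y → Y y × A s y)

    module _ {d Y s} (g : Generic d Y s) where
      open Generic g

      -- Greedy choice: after `x`, continue in `Z (suc x)`, all of whose points exceed `x` and are
      -- joined to it.
      generic-clique : ∀ N j → Clique colour N (λ y → Z j y × A s y)
      generic-clique zero    j = (λ ()) , (λ ()) , λ {}
      generic-clique (suc N) j =
        let x , Zx , Ax    = large-inhabited d s (Z-large j)
            F , F∈ , F<    = generic-clique N (suc x)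
        in (λ { zero → x ; (suc i) → F i }) ,
           (λ { zero    → Zx , Ax
              ; (suc i) → Z-antitone (≤-trans (Z-≥ Zx) (n≤1+n x)) (F i) (proj₁ (F∈ i))
                        , proj₂ (F∈ i) }) ,
           λ { {zero}  {suc j} _         → Z-≥ (proj₁ (F∈ j))
                                         , joined ≤-refl Zx (proj₁ (F∈ j))
             ; {suc i} {suc j} (s≤s i<j) → F< i<j }

      generic-unbounded : ¬ Bounded Y s colour
      generic-unbounded (N , none) =
        none (clique-mono (λ y → Z 0 y × A s y) (λ y → Y y × A s y)
          (λ y (Zy , Ay) → Z⊆Y 0 y Zy , Ay) (generic-clique N 0))

      -- Quantifying over pairs lets a single use of `¬∀⟶∃¬` return both the failing `j` and `N`.
      CliquesBelow : Set
      CliquesBelow = ∀ ((j , N) : ℕ × ℕ) →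
        ∃[ k ] (N ≤ k × Clique colour N (λ y → Z j y × A (s ⌢ k) y))

      -- Gluing cliques below infinitely many children.

      module _ (cliques : CliquesBelow) where

        -- Stage `i` takes a clique of size `i` in `Z (start i)`. Since `start (suc i)` exceeds all
        -- points of stages up to `i`, `joined` governs pairs from different stages.
        start  : ℕ → ℕ
        points : ∀ i → Fin i → ℕ

        start zero    = 0
        start (suc i) = suc (proj₁ (upper-bound (points i)) ⊔ start i)
        points i      = proj₁ (proj₂ (proj₂ (cliques (start i , i))))

        points-∈ : ∀ i a → Z (start i) (points i a) ×
                           A (s ⌢ proj₁ (cliques (start i , i))) (points i a)
        points-∈ i = proj₁ (proj₂ (proj₂ (proj₂ (cliques (start i , i)))))

        points-clique : ∀ i {a b} → a Fin.< b →
          points i a < points i b × c (points i a) (points i b) ≡ colour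
        points-clique i = proj₂ (proj₂ (proj₂ (proj₂ (cliques (start i , i)))))

        start-≥ : ∀ i → i ≤ start i
        start-≥ zero    = z≤n
        start-≥ (suc i) = s≤s (≤-trans (start-≥ i) (m≤n⊔m _ (start i)))

        start≤points : ∀ i a → start i ≤ points i a
        start≤points i a = Z-≥ (proj₁ (points-∈ i a))

        points<start : ∀ {i j} a → i < j → points i a < start j
        points<start {i} {suc j} a (s≤s i≤j) with m≤n⇒m<n∨m≡n i≤j
        ... | inj₁ i<j  =
          s≤s (≤-trans (<⇒≤ (points<start a i<j)) (m≤n⊔m _ (start j)))
        ... | inj₂ refl =
          s≤s (≤-trans (proj₂ (upper-bound (points i)) a) (m≤m⊔n _ (start i)))

        Union : Subset
        Union x = ∃[ i ] Σ (Fin i) λ a → points i a ≡ x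

        union-tall : Tall s Union
        union-tall N =
          let k , N≤k , _ = cliques (start N , N)
          in k , N≤k , points N ,
             (λ a → (N , a , refl) , proj₂ (points-∈ N a)
                  , ≤-trans (start-≥ N) (start≤points N a)) ,
             λ a<b → proj₁ (points-clique N a<b)

        union-homogeneous : Homogeneous c Union
        union-homogeneous = colour , λ where
            _ _ x<y (i , a , refl) (j , b , refl) → edge i a j b x<y
          where
          edge : ∀ i a j b → points i a < points j b →
                 c (points i a) (points j b) ≡ colour
          edge i a j b x<y with <-cmp i j
          ... | tri< i<j _ _ =
            joined (points<start a i<j) (proj₁ (points-∈ i a)) (proj₁ (points-∈ j b))
          ... | tri> _ _ j<i = contradiction x<y
            (<⇒≯ (<-≤-trans (points<start b j<i) (start≤points i a)))
          ... | tri≈ _ refl _ with Fin.<-cmp a b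
          ...   | tri< a<b _ _  = proj₂ (points-clique i a<b)
          ...   | tri≈ _ refl _ = contradiction refl (<⇒≢ x<y)
          ...   | tri> _ _ b<a  = contradiction x<y (<⇒≯ (proj₁ (points-clique i b<a)))

      -- Bounds survive shrinking the set, and the generic colour becomes bounded, so its index `i`
      -- can be deleted from `v`.
      bounded-in-child : ∀ {m} (v : Fin (suc m) → Fin n) i → v i ≡ colour → ∀ j k →
        (∀ e → Bounded Y s e ⊎ ∃[ a ] v a ≡ e) → Bounded (Z j) (s ⌢ k) colour →
        ∀ e → Bounded (Z j) (s ⌢ k) e ⊎ ∃[ a ] v (punchIn i a) ≡ e
      bounded-in-child v i vi≡ j k bounded new e with e Fin.≟ colour | bounded e
      ... | yes refl | _               = inj₁ new
      ... | no  _    | inj₁ (N , none) = inj₁ (N , λ C → none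
        (clique-mono (λ y → Z j y × A (s ⌢ k) y) (λ y → Y y × A s y)
          (λ y (Zy , Ay) → Z⊆Y j y Zy , sub s k y Ay) C))
      ... | no  e≢   | inj₂ (a , va≡) =
        let i≢a = λ i≡a → e≢ (trans (sym va≡) (trans (cong v (sym i≡a)) vi≡))
        in inj₂ (punchOut i≢a , trans (cong v (punchIn-punchOut i≢a)) va≡)

    -- v lists the colours whose cliques may still be unbounded, so that the number
    -- of these colours is the number of levels left.
    tall-homogeneous : ∀ d (v : Fin d → Fin n) {Y s} → Generic d Y s →
      (∀ e → Bounded Y s e ⊎ ∃[ i ] v i ≡ e) →
      ∃[ t ] Σ Subset λ X → Tall t X × Homogeneous c X
    tall-homogeneous d v g bounded
      with bounded (Generic.colour g)
    ... | inj₁ b = contradiction b (generic-unbounded g)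
    -- Depth zero cannot occur here: `Fin 0` offers no index `i`.
    tall-homogeneous (suc d) v {s = s} g bounded | inj₂ (i , vi≡)
      with dec (CliquesBelow g)
    ... | yes cliques = s , Union g cliques ,
      union-tall g cliques , union-homogeneous g cliques
    ... | no ¬cliques =
      -- No child `k` with `N ≤ k` contains an `N`-clique of `Z j`; largeness supplies such a child,
      -- with one level fewer.
      let (j , N) , none = ¬∀⟶∃¬ ¬cliques
          k , N≤k , L′   = Generic.Z-large g j N
      in tall-homogeneous d (v ∘ punchIn i) (generic L′)
           (bounded-in-child g v i vi≡ j k bounded
             (N , λ C → none (k , N≤k , C)))

theorem2p2 : ExcludedMiddle (lsuc 0ℓ) →
    (A : Seq → Subset) → IsTreeFamily A →
    (n : ℕ) → Arrow (ED̃ω A) n × Arrow (PC A) n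
theorem2p2 em A tree n =
    (λ c → let s , X , tall , hom = solution c in
      X , (λ X∈ED̃ω → tall-positive s _
             (λ G → [ thin-𝓐 s G , thin-𝓑 s G ]′) X tall (X∈ED̃ω (length s))) , hom) ,
    (λ c → let s , X , tall , hom = solution c in
      X , tall-positive s _
             (λ G → [ thin-𝓑 s G , thin-small-branching s G ]′) X tall , hom)
  where
  open TreeFamily em A tree

  solution : (c : ℕ → ℕ → Fin n) → ∃[ s ] Σ Subset λ X → Tall s X × Homogeneous c X
  solution c = Colouring.tall-homogeneous c n id
    (Colouring.generic c (large-everything n [])) (λ e → inj₂ (e , refl))
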